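{- Computability is stable over the structure $\langle\mathbb{Q},+,\times\rangle$ of the rational numbers with addition and multiplication.
   Context: Computability over natural numbers is the usual one. A set $A \subseteq \mathbb{N}$ is effectively enumerable if it is empty or the image of a total computable function from $\mathbb{N}$ to $\mathbb{N}$. For $A \subseteq \mathbb{N}^m$ and $B \subseteq \mathbb{N}$, a computable function from $A$ to $B$ is a partial computable function that is defined at every element of $A$ and takes values in $B$ there. Indexing: an indexing of a set $E$ is a partial function $i$ from $\mathbb{N}$ to $E$ such that $dom(i)$ is effectively enumerable, $i$ is surjective, and there is a computable function $eq$ from $dom(i)\times dom(i)$ to $\{0,1\}$ with $eq(x,y)=1$ if $i(x)=i(y)$ and $eq(x,y)=0$ otherwise. An indexing $i$ of the set $E$ is an admissible indexing of a one-sorted structure $\langle E,op_1,\ldots,op_p\rangle$ if every operation $op: E^m\to E$ among $op_1,\ldots,op_p$ is computable relatively to $i$, that is, there is a computable function $\hat{op}$ from $dom(i)^m$ to $dom(i)$ such that $i(\hat{op}(x_1,\ldots,x_m)) = op(i(x_1),\ldots,i(x_m))$ for all $x_1,\ldots,x_m\in dom(i)$. Computability is stable over $\langle E,op_1,\ldots,op_p\rangle$ if there exists an admissible indexing of this structure and, for all admissible indexings $j$ and $j'$ of it, there exists a computable function $h$ from $dom(j')$ to $dom(j)$ such that $j' = j\circ h$. -}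

module Defs where

open import Data.Fin using (Fin)
open import Data.List using (List; []; _∷_)
import Data.List.Relation.Unary.All as ListAll
open import Data.Nat using (ℕ; suc; _<_)
open import Data.Nat.Properties using (<-cmp)
open import Data.Product using (Σ; ∃; ∃-syntax; _×_; _,_)
open import Data.Rational using (ℚ; _+_; _*_)
open import Data.Sum using (_⊎_)
open import Data.Vec using (Vec; []; _∷_; lookup)
open import Data.Vec.Relation.Binary.Pointwise.Inductive using (Pointwise)
open import Data.Vec.Relation.Unary.All using (All)
open import Function.Bundles using (_⇔_)
open import Level using (0ℓ)
open import Relation.Binary.Definitions using (tri<; tri≈; tri>)
open import Relation.Binary.PropositionalEquality using (_≡_; _≢_; refl)
open import Relation.Nullary using (contradiction)
open import Relation.Unary using (Pred; _∈_; Empty; U)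

private
  variable
    m n : ℕ

-- Partial computable functions ℕⁿ ⇀ ℕ are those denoted by μ-recursive terms.

data Rec : ℕ → Set where
  zero : Rec n
  succ : Rec 1
  proj : Fin n → Rec n
  comp : Rec m → Vec (Rec n) m → Rec n
  prec : Rec n → Rec (suc (suc n)) → Rec (suc n)
  mu   : Rec (suc n) → Rec n

infix 4 _[_]↦_ _[_]↦*_

mutual
  data _[_]↦_ : Rec n → Vec ℕ n → ℕ → Set where
    zero  : {xs : Vec ℕ n} → zero [ xs ]↦ 0
    succ  : ∀ {x} → succ [ x ∷ [] ]↦ suc x
    proj  : {i : Fin n} {xs : Vec ℕ n} → proj i [ xs ]↦ lookup xs i
    comp  : {f : Rec m} {gs : Vec (Rec n) m} {xs : Vec ℕ n} {ys : Vec ℕ m} {z : ℕ} →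
            gs [ xs ]↦* ys → f [ ys ]↦ z → comp f gs [ xs ]↦ z
    prec₀ : {f : Rec n} {g : Rec (suc (suc n))} {xs : Vec ℕ n} {z : ℕ} →
            f [ xs ]↦ z → prec f g [ 0 ∷ xs ]↦ z
    precₛ : {f : Rec n} {g : Rec (suc (suc n))} {xs : Vec ℕ n} {x y z : ℕ} →
            prec f g [ x ∷ xs ]↦ y → g [ x ∷ y ∷ xs ]↦ z →
            prec f g [ suc x ∷ xs ]↦ z
    mu    : {f : Rec (suc n)} {xs : Vec ℕ n} {y : ℕ} →
            f [ y ∷ xs ]↦ 0 →
            (∀ {z} → z < y → ∃[ w ] f [ z ∷ xs ]↦ suc w) →
            mu f [ xs ]↦ y

  data _[_]↦*_ {n} : Vec (Rec n) m → Vec ℕ n → Vec ℕ m → Set where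
    []  : {xs : Vec ℕ n} → [] [ xs ]↦* []
    _∷_ : {f : Rec n} {fs : Vec (Rec n) m} {xs : Vec ℕ n} {y : ℕ} {ys : Vec ℕ m} →
          f [ xs ]↦ y → fs [ xs ]↦* ys → (f ∷ fs) [ xs ]↦* (y ∷ ys)

mutual
  ↦-functional : (f : Rec n) {xs : Vec ℕ n} {y z : ℕ} →
                 f [ xs ]↦ y → f [ xs ]↦ z → y ≡ z
  ↦-functional zero zero zero = refl
  ↦-functional succ succ succ = refl
  ↦-functional (proj i) proj proj = refl
  ↦-functional (comp f gs) (comp ps p) (comp qs q)
    with refl ← ↦*-functional gs ps qs = ↦-functional f p q
  ↦-functional (prec f g) (prec₀ p) (prec₀ q) = ↦-functional f p q
  ↦-functional (prec f g) (precₛ p p′) (precₛ q q′)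
    with refl ← ↦-functional (prec f g) p q = ↦-functional g p′ q′
  ↦-functional (mu f) {y = y} {z = z} (mu p p<) (mu q q<) with <-cmp y z
  ... | tri≈ _ y≡z _ = y≡z
  ... | tri< y<z _ _ with _ , r ← q< y<z = contradiction (↦-functional f p r) λ ()
  ... | tri> _ _ z<y with _ , r ← p< z<y = contradiction (↦-functional f q r) λ ()

  ↦*-functional : (fs : Vec (Rec n) m) {xs : Vec ℕ n} {ys zs : Vec ℕ m} →
                  fs [ xs ]↦* ys → fs [ xs ]↦* zs → ys ≡ zs
  ↦*-functional [] [] [] = refl
  ↦*-functional (f ∷ fs) (p ∷ ps) (q ∷ qs)
    with refl ← ↦-functional f p q | refl ← ↦*-functional fs ps qs = refl

infix 8 _^_

_^_ : Pred ℕ 0ℓ → (m : ℕ) → Pred (Vec ℕ m) 0ℓ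
(A ^ m) xs = All A xs

-- A term may also be defined outside A; nothing is required of it there.
record Computable (A : Pred (Vec ℕ m) 0ℓ) (B : Pred ℕ 0ℓ) : Set where
  field
    term    : Rec m
    defined : ∀ {xs} → xs ∈ A → ∃[ y ] (y ∈ B × term [ xs ]↦ y)

open Computable public using (term)

EffectivelyEnumerable : Pred ℕ 0ℓ → Set
EffectivelyEnumerable A =
  Empty A ⊎ Σ (Computable {1} U U) λ f → ∀ x → x ∈ A ⇔ (∃[ n ] term f [ n ∷ [] ]↦ x)

record PartialFunction (E : Set) : Set₁ where
  field
    graph      : ℕ → E → Set
    functional : ∀ {x e e′} → graph x e → graph x e′ → e ≡ e′

  dom : Pred ℕ 0ℓ
  dom x = ∃[ e ] graph x e

Bit : Pred ℕ 0ℓ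
Bit b = b ≡ 0 ⊎ b ≡ 1

record Indexing (E : Set) : Set₁ where
  field
    partialFunction : PartialFunction E

  open PartialFunction partialFunction public

  field
    dom-enumerable : EffectivelyEnumerable dom
    surjective     : ∀ e → ∃[ x ] graph x e
    eq             : Computable (dom ^ 2) Bit
    eq-≡           : ∀ {x y e e′} → graph x e → graph y e′ →
                     e ≡ e′ → term eq [ x ∷ y ∷ [] ]↦ 1
    eq-≢           : ∀ {x y e e′} → graph x e → graph y e′ →
                     e ≢ e′ → term eq [ x ∷ y ∷ [] ]↦ 0

Operation : Set → Set
Operation E = ∃[ m ] (Vec E m → E)

record Structure : Set₁ where
  constructor ⟨_,_⟩
  field
    Carrier    : Set
    operations : List (Operation Carrier)

ComputableRelativelyTo : {E : Set} → Indexing E → Operation E → Set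
ComputableRelativelyTo i (m , op) =
  Σ (Computable (dom ^ m) dom) λ ôp →
    ∀ {xs es} → Pointwise graph xs es →
    ∃[ y ] (term ôp [ xs ]↦ y × graph y (op es))
  where open Indexing i

record AdmissibleIndexing (S : Structure) : Set₁ where
  open Structure S
  field
    indexing   : Indexing Carrier
    admissible : ListAll.All (ComputableRelativelyTo indexing) operations

  open Indexing indexing public

-- The equality j′ = j ∘ h, where h is regarded as a function on dom(j′) only.
_≗_∘_ : {E : Set} (j′ j : Indexing E) →
        Computable (Indexing.dom j′ ^ 1) (Indexing.dom j) → Set
j′ ≗ j ∘ h =
  ∀ {x} → x ∈ J′.dom → ∀ e →
  J′.graph x e ⇔ (∃[ y ] (term h [ x ∷ [] ]↦ y × J.graph y e))
  where
    module J  = Indexing j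
    module J′ = Indexing j′

Stable : Structure → Set₁
Stable S =
  AdmissibleIndexing S ×
  ((j j′ : AdmissibleIndexing S) →
   let module J  = AdmissibleIndexing j
       module J′ = AdmissibleIndexing j′
   in Σ (Computable (J′.dom ^ 1) J.dom) λ h → J′.indexing ≗ J.indexing ∘ h)

binary : {E : Set} → (E → E → E) → Operation E
binary _∙_ = 2 , λ { (x ∷ y ∷ []) → x ∙ y }

⟨ℚ,+,×⟩ : Structure
⟨ℚ,+,×⟩ = ⟨ ℚ , binary _+_ ∷ binary _*_ ∷ [] ⟩

{-# OPTIONS --safe #-}

-- Call n a name of q when q·k + k³ + k² = n, where k ≥ 1 is the integer part of
-- the cube root of n (and k = 1 for n = 0). Every n names exactly one rational,
-- (n − k³)/k − k, and since n − k³ ranges over [0, 3k²+3k], every rational is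
-- named by some n with k a large multiple of its denominator. Clearing
-- denominators, equality, sum and product of named rationals reduce to equations
-- between natural numbers, solved by unbounded search, so names form an
-- admissible indexing. Conversely the naming equation only involves +, ×, and
-- natural number constants, so in any admissible indexing one can decide whether
-- n names the rational with a given index. Hence a name is found from an index
-- of j′ by search over ℕ, and then an index of j from that name by search over
-- an enumeration of dom(j).

module Submission where

open import Data.Fin using (#_)
open import Data.Integer as ℤ using (+_; -[1+_])
import Data.Integer.Properties as ℤₚ
open import Data.List.Relation.Unary.All using ([]; _∷_)
open import Data.Nat as ℕ using (ℕ; zero; suc; pred; _∸_; s≤s)
import Data.Nat.Properties as ℕₚ
open import Data.Nat.Solver using () renaming (module +-*-Solver to ℕ-Solver)
open import Data.Product using (∃; ∃-syntax; _×_; _,_; proj₁; proj₂)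
open import Data.Rational as ℚ using (ℚ; mkℚ; 0ℚ; 1ℚ; 1/_; _+_; _*_; _-_; toℚᵘ; NonZero; ≢-nonZero)
import Data.Rational.Properties as ℚₚ
open import Data.Rational.Solver using () renaming (module +-*-Solver to ℚ-Solver)
open import Data.Rational.Unnormalised as ℚᵘ using (mkℚᵘ; _≃_; *≡*)
import Data.Rational.Unnormalised.Properties as ℚᵘₚ
open import Data.Sum using (inj₁; inj₂)
open import Data.Unit using (tt)
open import Data.Vec using (Vec; []; _∷_)
open import Data.Vec.Relation.Binary.Pointwise.Inductive using ([]; _∷_)
open import Data.Vec.Relation.Unary.All using ([]; _∷_)
open import Function.Base using (_$_)
open import Function.Bundles using (mk⇔; Equivalence)
open import Relation.Binary.PropositionalEquality using (_≡_; _≢_; refl; sym; trans; cong; cong₂; subst; module ≡-Reasoning)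
open import Relation.Nullary using (yes; no; contradiction)
open import Relation.Unary using (U)
import Algebra.Bundles as Bundles
import Algebra.Properties.Semiring.Mult as Mult
open import Algebra.Properties.Ring ℚₚ.+-*-ring using (+-cancelʳ)

open import Defs

private
  variable
    n a b d u v u′ v′ d′ : ℕ
    f g : Rec n
    xs : Vec ℕ n
    p q : ℚ

-- μ-recursive terms

↦-subst : a ≡ b → f [ xs ]↦ a → f [ xs ]↦ b
↦-subst refl r = r

mu-total : (∀ z → ∃[ w ] f [ z ∷ xs ]↦ w) → f [ a ∷ xs ]↦ 0 →
           ∃[ y ] (mu f [ xs ]↦ y × f [ y ∷ xs ]↦ 0)
mu-total {f = f} {xs = xs} {a = a} total zeroAt =
  go a 0 (λ ()) (subst (λ i → f [ i ∷ xs ]↦ 0) (sym (ℕₚ.+-identityʳ a)) zeroAt)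
  where
  go : ∀ fuel y → (∀ {z} → z ℕ.< y → ∃[ w ] f [ z ∷ xs ]↦ suc w) →
       f [ fuel ℕ.+ y ∷ xs ]↦ 0 → ∃[ y ] (mu f [ xs ]↦ y × f [ y ∷ xs ]↦ 0)
  go zero y below r = y , mu r below , r
  go (suc fuel) y below r with total y
  ... | zero  , r′ = y , mu r′ below , r′
  ... | suc w , r′ = go fuel (suc y) below′ (subst (λ i → f [ i ∷ xs ]↦ 0) (sym (ℕₚ.+-suc fuel y)) r)
    where
    below′ : ∀ {z} → z ℕ.< suc y → ∃[ w ] f [ z ∷ xs ]↦ suc w
    below′ z<1+y with ℕₚ.m<1+n⇒m<n∨m≡n z<1+y
    ... | inj₁ z<y  = below z<y
    ... | inj₂ refl = w , r′

comp₁-↦ : {h : Rec 1} → f [ xs ]↦ a → h [ a ∷ [] ]↦ b → comp h (f ∷ []) [ xs ]↦ b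
comp₁-↦ r s = comp (r ∷ []) s

const : ℕ → Rec n
const zero    = zero
const (suc a) = comp succ (const a ∷ [])

const-↦ : ∀ a → const a [ xs ]↦ a
const-↦ zero    = zero
const-↦ (suc a) = comp₁-↦ (const-↦ a) succ

sucᵣ : Rec n → Rec n
sucᵣ f = comp succ (f ∷ [])

suc-↦ : f [ xs ]↦ a → sucᵣ f [ xs ]↦ suc a
suc-↦ r = comp₁-↦ r succ

add : Rec 2
add = prec (proj (# 0)) (sucᵣ (proj (# 1)))

add-↦ : ∀ a b → add [ a ∷ b ∷ [] ]↦ a ℕ.+ b
add-↦ zero    b = prec₀ proj
add-↦ (suc a) b = precₛ (add-↦ a b) (suc-↦ proj)

infixl 6 _⊕_ _⊖_
infixl 7 _⊗_

_⊕_ : Rec n → Rec n → Rec n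
f ⊕ g = comp add (f ∷ g ∷ [])

⊕-↦ : f [ xs ]↦ a → g [ xs ]↦ b → (f ⊕ g) [ xs ]↦ a ℕ.+ b
⊕-↦ r s = comp (r ∷ s ∷ []) (add-↦ _ _)

mul : Rec 2
mul = prec zero (proj (# 2) ⊕ proj (# 1))

mul-↦ : ∀ a b → mul [ a ∷ b ∷ [] ]↦ a ℕ.* b
mul-↦ zero    b = prec₀ zero
mul-↦ (suc a) b = precₛ (mul-↦ a b) (⊕-↦ proj proj)

_⊗_ : Rec n → Rec n → Rec n
f ⊗ g = comp mul (f ∷ g ∷ [])

⊗-↦ : f [ xs ]↦ a → g [ xs ]↦ b → (f ⊗ g) [ xs ]↦ a ℕ.* b
⊗-↦ r s = comp (r ∷ s ∷ []) (mul-↦ _ _)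

predecessor : Rec 1
predecessor = prec zero (proj (# 0))

predecessor-↦ : ∀ a → predecessor [ a ∷ [] ]↦ pred a
predecessor-↦ zero    = prec₀ zero
predecessor-↦ (suc a) = precₛ (predecessor-↦ a) proj

-- The arguments are swapped because prec recurses on its first argument.
monus : Rec 2
monus = prec (proj (# 0)) (comp predecessor (proj (# 1) ∷ []))

monus-↦ : ∀ a b → monus [ a ∷ b ∷ [] ]↦ b ∸ a
monus-↦ zero    b = prec₀ proj
monus-↦ (suc a) b = precₛ (monus-↦ a b)
  (↦-subst (ℕₚ.pred[m∸n]≡m∸[1+n] b a) (comp₁-↦ proj (predecessor-↦ _)))

_⊖_ : Rec n → Rec n → Rec n
f ⊖ g = comp monus (g ∷ f ∷ [])

⊖-↦ : f [ xs ]↦ a → g [ xs ]↦ b → (f ⊖ g) [ xs ]↦ a ∸ b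
⊖-↦ r s = comp (s ∷ r ∷ []) (monus-↦ _ _)

infix 5 _⊜_

-- Takes the value 0 exactly where f and g agree, as mu requires.
_⊜_ : Rec n → Rec n → Rec n
f ⊜ g = (f ⊖ g) ⊕ (g ⊖ f)

⊜-↦ : f [ xs ]↦ a → g [ xs ]↦ b → (f ⊜ g) [ xs ]↦ (a ∸ b) ℕ.+ (b ∸ a)
⊜-↦ r s = ⊕-↦ (⊖-↦ r s) (⊖-↦ s r)

distance-refl : a ≡ b → (a ∸ b) ℕ.+ (b ∸ a) ≡ 0
distance-refl {a} refl = cong₂ ℕ._+_ (ℕₚ.n∸n≡0 a) (ℕₚ.n∸n≡0 a)

distance-zero : (a ∸ b) ℕ.+ (b ∸ a) ≡ 0 → a ≡ b
distance-zero {a} {b} eq = ℕₚ.≤-antisym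
  (ℕₚ.m∸n≡0⇒m≤n (ℕₚ.m+n≡0⇒m≡0 (a ∸ b) eq))
  (ℕₚ.m∸n≡0⇒m≤n (ℕₚ.m+n≡0⇒n≡0 (a ∸ b) eq))

isZero : Rec n → Rec n
isZero f = comp (prec (const 1) zero) (f ∷ [])

isZero-0 : f [ xs ]↦ 0 → isZero f [ xs ]↦ 1
isZero-0 r = comp₁-↦ r (prec₀ (const-↦ 1))

isZero-suc : f [ xs ]↦ suc a → isZero f [ xs ]↦ 0
isZero-suc r = comp₁-↦ r (go _)
  where
  go : ∀ a → prec (const 1) zero [ suc a ∷ [] ]↦ 0
  go zero    = precₛ (prec₀ (const-↦ 1)) zero
  go (suc a) = precₛ (go a) zero

isZero-≢0 : a ≢ 0 → f [ xs ]↦ a → isZero f [ xs ]↦ 0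
isZero-≢0 {zero}  a≢0 _ = contradiction refl a≢0
isZero-≢0 {suc a} _   r = isZero-suc r

-- Natural numbers inside ℚ

open Mult (Bundles.CommutativeRing.semiring ℚₚ.+-*-commutativeRing)
  using (×-homo-+; ×1-homo-*) renaming (_×_ to _×ℚ_)

infix 9 ↑_

↑_ : ℕ → ℚ
↑ n = n ×ℚ 1ℚ

↑-+ : ∀ a b → ↑ (a ℕ.+ b) ≡ ↑ a + ↑ b
↑-+ = ×-homo-+ 1ℚ

↑-* : ∀ a b → ↑ (a ℕ.* b) ≡ ↑ a * ↑ b
↑-* = ×1-homo-*

toℚᵘ-↑ : ∀ n → toℚᵘ (↑ n) ≃ mkℚᵘ (+ n) 0
toℚᵘ-↑ zero    = *≡* refl
toℚᵘ-↑ (suc n) = begin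
  toℚᵘ (1ℚ + ↑ n)               ≈⟨ ℚₚ.toℚᵘ-homo-+ 1ℚ (↑ n) ⟩
  toℚᵘ 1ℚ ℚᵘ.+ toℚᵘ (↑ n)       ≈⟨ ℚᵘₚ.+-congʳ (toℚᵘ 1ℚ) (toℚᵘ-↑ n) ⟩
  mkℚᵘ (+ 1) 0 ℚᵘ.+ mkℚᵘ (+ n) 0 ≈⟨ *≡* (cong (λ i → (+ 1 ℤ.+ i) ℤ.* + 1) (ℤₚ.*-identityʳ (+ n))) ⟩
  mkℚᵘ (+ suc n) 0              ∎
  where open import Relation.Binary.Reasoning.Setoid ℚᵘₚ.≃-setoid

↑-injective : ↑ a ≡ ↑ b → a ≡ b
↑-injective {a} {b} eq with
  *≡* e ← ℚᵘₚ.≃-trans (ℚᵘₚ.≃-sym (toℚᵘ-↑ a)) (ℚᵘₚ.≃-trans (ℚₚ.toℚᵘ-cong eq) (toℚᵘ-↑ b))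
  = ℤₚ.+-injective (ℤₚ.*-cancelʳ-≡ (+ a) (+ b) (+ 1) e)

↑-nonZero : .{{_ : ℕ.NonZero a}} → NonZero (↑ a)
↑-nonZero {a} = ≢-nonZero λ eq → ℕ.≢-nonZero⁻¹ a (↑-injective eq)

*-cancelʳ-≡ : ∀ r .{{_ : NonZero r}} → p * r ≡ q * r → p ≡ q
*-cancelʳ-≡ {p} {q} r eq = trans (sym (undo p)) (trans (cong (_* 1/ r) eq) (undo q))
  where
  undo : ∀ x → x * r * 1/ r ≡ x
  undo x = trans (ℚₚ.*-assoc x r (1/ r)) (trans (cong (x *_) (ℚₚ.*-inverseʳ r)) (ℚₚ.*-identityʳ x))

-- q = (u − v)/d, stated without subtraction or division.
record Fraction (u v d : ℕ) (q : ℚ) : Set where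
  constructor cleared
  field
    equation : q * ↑ d + ↑ v ≡ ↑ u

open Fraction

module _ where
  open ℚ-Solver
  open ≡-Reasoning

  ↑-cross : ∀ a b c d → ↑ (a ℕ.* b ℕ.+ c ℕ.* d) ≡ ↑ a * ↑ b + ↑ c * ↑ d
  ↑-cross a b c d = trans (↑-+ (a ℕ.* b) (c ℕ.* d)) (cong₂ _+_ (↑-* a b) (↑-* c d))

  fraction-+ : Fraction u v d p → Fraction u′ v′ d′ q →
    Fraction (u ℕ.* d′ ℕ.+ u′ ℕ.* d) (v ℕ.* d′ ℕ.+ v′ ℕ.* d) (d ℕ.* d′) (p + q)
  fraction-+ {u} {v} {d} {p} {u′} {v′} {d′} {q} (cleared e) (cleared e′) = cleared (begin
    (p + q) * ↑ (d ℕ.* d′) + ↑ (v ℕ.* d′ ℕ.+ v′ ℕ.* d)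
      ≡⟨ cong₂ (λ x y → (p + q) * x + y) (↑-* d d′) (↑-cross v d′ v′ d) ⟩
    (p + q) * (↑ d * ↑ d′) + (↑ v * ↑ d′ + ↑ v′ * ↑ d)
      ≡⟨ solve 6 (λ p q d d′ v v′ →
           (p :+ q) :* (d :* d′) :+ (v :* d′ :+ v′ :* d) :=
           (p :* d :+ v) :* d′ :+ (q :* d′ :+ v′) :* d) refl p q (↑ d) (↑ d′) (↑ v) (↑ v′) ⟩
    (p * ↑ d + ↑ v) * ↑ d′ + (q * ↑ d′ + ↑ v′) * ↑ d
      ≡⟨ cong₂ (λ x y → x * ↑ d′ + y * ↑ d) e e′ ⟩
    ↑ u * ↑ d′ + ↑ u′ * ↑ d
      ≡⟨ ↑-cross u d′ u′ d ⟨
    ↑ (u ℕ.* d′ ℕ.+ u′ ℕ.* d) ∎)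

  fraction-* : Fraction u v d p → Fraction u′ v′ d′ q →
    Fraction (u ℕ.* u′ ℕ.+ v ℕ.* v′) (u ℕ.* v′ ℕ.+ v ℕ.* u′) (d ℕ.* d′) (p * q)
  fraction-* {u} {v} {d} {p} {u′} {v′} {d′} {q} (cleared e) (cleared e′) = cleared (begin
    p * q * ↑ (d ℕ.* d′) + ↑ (u ℕ.* v′ ℕ.+ v ℕ.* u′)
      ≡⟨ cong₂ (λ x y → p * q * x + y) (↑-* d d′) (↑-cross u v′ v u′) ⟩
    p * q * (↑ d * ↑ d′) + (↑ u * ↑ v′ + ↑ v * ↑ u′)
      ≡⟨ cong₂ (λ x y → p * q * (↑ d * ↑ d′) + (x * ↑ v′ + ↑ v * y)) e e′ ⟨
    p * q * (↑ d * ↑ d′) + ((p * ↑ d + ↑ v) * ↑ v′ + ↑ v * (q * ↑ d′ + ↑ v′))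
      ≡⟨ solve 6 (λ p q d d′ v v′ →
           (p :* q) :* (d :* d′) :+ ((p :* d :+ v) :* v′ :+ v :* (q :* d′ :+ v′)) :=
           (p :* d :+ v) :* (q :* d′ :+ v′) :+ v :* v′) refl p q (↑ d) (↑ d′) (↑ v) (↑ v′) ⟩
    (p * ↑ d + ↑ v) * (q * ↑ d′ + ↑ v′) + ↑ v * ↑ v′
      ≡⟨ cong₂ (λ x y → x * y + ↑ v * ↑ v′) e e′ ⟩
    ↑ u * ↑ u′ + ↑ v * ↑ v′
      ≡⟨ ↑-cross u u′ v v′ ⟨
    ↑ (u ℕ.* u′ ℕ.+ v ℕ.* v′) ∎)

  fraction-cross : ∀ v′ d′ → Fraction u v d p →
    ↑ (u ℕ.* d′ ℕ.+ v′ ℕ.* d) ≡ p * (↑ d * ↑ d′) + (↑ v * ↑ d′ + ↑ v′ * ↑ d)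
  fraction-cross {u} {v} {d} {p} v′ d′ (cleared e) = begin
    ↑ (u ℕ.* d′ ℕ.+ v′ ℕ.* d)             ≡⟨ ↑-cross u d′ v′ d ⟩
    ↑ u * ↑ d′ + ↑ v′ * ↑ d               ≡⟨ cong (λ x → x * ↑ d′ + ↑ v′ * ↑ d) e ⟨
    (p * ↑ d + ↑ v) * ↑ d′ + ↑ v′ * ↑ d
      ≡⟨ solve 5 (λ p d d′ v v′ →
           (p :* d :+ v) :* d′ :+ v′ :* d :=
           p :* (d :* d′) :+ (v :* d′ :+ v′ :* d)) refl p (↑ d) (↑ d′) (↑ v) (↑ v′) ⟩
    p * (↑ d * ↑ d′) + (↑ v * ↑ d′ + ↑ v′ * ↑ d) ∎

  swap-cross : ∀ q d d′ v v′ → q * (d′ * d) + (v′ * d + v * d′) ≡ q * (d * d′) + (v * d′ + v′ * d)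
  swap-cross q d d′ v v′ = cong₂ (λ x y → q * x + y) (ℚₚ.*-comm d′ d) (ℚₚ.+-comm (v′ * d) (v * d′))

  fraction-shift : ∀ w → Fraction u v d q → Fraction (u ℕ.+ w) (v ℕ.+ w) d q
  fraction-shift {u} {v} {d} {q} w (cleared e) = cleared (begin
    q * ↑ d + ↑ (v ℕ.+ w)   ≡⟨ cong (λ x → q * ↑ d + x) (↑-+ v w) ⟩
    q * ↑ d + (↑ v + ↑ w)   ≡⟨ ℚₚ.+-assoc (q * ↑ d) (↑ v) (↑ w) ⟨
    q * ↑ d + ↑ v + ↑ w     ≡⟨ cong (_+ ↑ w) e ⟩
    ↑ u + ↑ w               ≡⟨ ↑-+ u w ⟨
    ↑ (u ℕ.+ w)             ∎)

  fraction-scale : ∀ m → Fraction u v d q → Fraction (u ℕ.* m) (v ℕ.* m) (d ℕ.* m) q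
  fraction-scale {u} {v} {d} {q} m (cleared e) = cleared (begin
    q * ↑ (d ℕ.* m) + ↑ (v ℕ.* m)   ≡⟨ cong₂ (λ x y → q * x + y) (↑-* d m) (↑-* v m) ⟩
    q * (↑ d * ↑ m) + ↑ v * ↑ m     ≡⟨ cong (_+ ↑ v * ↑ m) (ℚₚ.*-assoc q (↑ d) (↑ m)) ⟨
    q * ↑ d * ↑ m + ↑ v * ↑ m       ≡⟨ ℚₚ.*-distribʳ-+ (↑ m) (q * ↑ d) (↑ v) ⟨
    (q * ↑ d + ↑ v) * ↑ m           ≡⟨ cong (_* ↑ m) e ⟩
    ↑ u * ↑ m                       ≡⟨ ↑-* u m ⟨
    ↑ (u ℕ.* m)                     ∎)

fraction-≡⇒ : Fraction u v d p → Fraction u′ v′ d′ q → p ≡ q →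
              u ℕ.* d′ ℕ.+ v′ ℕ.* d ≡ u′ ℕ.* d ℕ.+ v ℕ.* d′
fraction-≡⇒ {v = v} {d} {p} {v′ = v′} {d′ = d′} e e′ refl = ↑-injective $
  trans (fraction-cross v′ d′ e) $
  trans (sym (swap-cross p (↑ d) (↑ d′) (↑ v) (↑ v′))) (sym (fraction-cross v d e′))

fraction-≡⇐ : .{{_ : ℕ.NonZero d}} .{{_ : ℕ.NonZero d′}} →
              Fraction u v d p → Fraction u′ v′ d′ q →
              u ℕ.* d′ ℕ.+ v′ ℕ.* d ≡ u′ ℕ.* d ℕ.+ v ℕ.* d′ → p ≡ q
fraction-≡⇐ {d} {d′} {v = v} {p = p} {v′ = v′} {q = q} e e′ eq =
  *-cancelʳ-≡ (↑ d) {{↑-nonZero}} $ *-cancelʳ-≡ (↑ d′) {{↑-nonZero}} $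
  trans (ℚₚ.*-assoc p (↑ d) (↑ d′)) $ trans eq′ (sym (ℚₚ.*-assoc q (↑ d) (↑ d′)))
  where
  eq′ : p * (↑ d * ↑ d′) ≡ q * (↑ d * ↑ d′)
  eq′ = +-cancelʳ (↑ v * ↑ d′ + ↑ v′ * ↑ d) _ _ $
    trans (sym (fraction-cross v′ d′ e)) $ trans (cong ↑_ eq) $
    trans (fraction-cross v d e′) (swap-cross q (↑ d) (↑ d′) (↑ v) (↑ v′))

fraction-total : ∀ u v d .{{_ : ℕ.NonZero d}} → ∃[ q ] Fraction u v d q
fraction-total u v d = (↑ u - ↑ v) * 1/ ↑ d , cleared (begin
  (↑ u - ↑ v) * 1/ ↑ d * ↑ d + ↑ v   ≡⟨ cong (_+ ↑ v) (ℚₚ.*-assoc (↑ u - ↑ v) _ (↑ d)) ⟩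
  (↑ u - ↑ v) * (1/ ↑ d * ↑ d) + ↑ v ≡⟨ cong (λ r → (↑ u - ↑ v) * r + ↑ v) (ℚₚ.*-inverseˡ (↑ d)) ⟩
  (↑ u - ↑ v) * 1ℚ + ↑ v             ≡⟨ solve 2 (λ u v → (u :- v) :* con 1ℚ :+ v := u) refl (↑ u) (↑ v) ⟩
  ↑ u                                ∎)
  where
  open ≡-Reasoning
  open ℚ-Solver
  instance
    ↑d≢0 : NonZero (↑ d)
    ↑d≢0 = ↑-nonZero

*-↧≃↥ : ∀ q → toℚᵘ (q * ↑ ℚ.↧ₙ q) ≃ mkℚᵘ (ℚ.↥ q) 0
*-↧≃↥ q@(mkℚ i d-1 _) = begin
  toℚᵘ (q * ↑ suc d-1)                  ≈⟨ ℚₚ.toℚᵘ-homo-* q (↑ suc d-1) ⟩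
  mkℚᵘ i d-1 ℚᵘ.* toℚᵘ (↑ suc d-1)      ≈⟨ ℚᵘₚ.*-congˡ {mkℚᵘ i d-1} (toℚᵘ-↑ (suc d-1)) ⟩
  mkℚᵘ i d-1 ℚᵘ.* mkℚᵘ (+ suc d-1) 0    ≈⟨ *≡* (trans (ℤₚ.*-assoc i (+ suc d-1) (+ 1))
                                             (cong (i ℤ.*_) (sym (ℤₚ.pos-* (suc d-1) 1)))) ⟩
  mkℚᵘ i 0                              ∎
  where open import Relation.Binary.Reasoning.Setoid ℚᵘₚ.≃-setoid

toFraction : ∀ q → ∃[ u ] ∃[ v ] ∃[ d ] Fraction u v (suc d) q
toFraction q@(mkℚ (+ a) d _) = a , 0 , d , cleared (trans (ℚₚ.+-identityʳ _)
  (ℚₚ.toℚᵘ-injective (ℚᵘₚ.≃-trans (*-↧≃↥ q) (ℚᵘₚ.≃-sym (toℚᵘ-↑ a)))))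
toFraction q@(mkℚ -[1+ a ] d _) = 0 , suc a , d , cleared (ℚₚ.toℚᵘ-injective (begin
  toℚᵘ (q * ↑ suc d + ↑ suc a)                ≈⟨ ℚₚ.toℚᵘ-homo-+ (q * ↑ suc d) (↑ suc a) ⟩
  toℚᵘ (q * ↑ suc d) ℚᵘ.+ toℚᵘ (↑ suc a)      ≈⟨ ℚᵘₚ.+-cong (*-↧≃↥ q) (toℚᵘ-↑ (suc a)) ⟩
  ℚᵘ.- mkℚᵘ (+ suc a) 0 ℚᵘ.+ mkℚᵘ (+ suc a) 0 ≈⟨ ℚᵘₚ.+-inverseˡ (mkℚᵘ (+ suc a) 0) ⟩
  toℚᵘ 0ℚ                                     ∎))
  where open import Relation.Binary.Reasoning.Setoid ℚᵘₚ.≃-setoid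

-- Names of rationals

cube : ℕ → ℕ
cube a = a ℕ.* a ℕ.* a

rootBody : Rec 2
rootBody = sucᵣ (proj (# 1)) ⊖ 2+s ⊗ 2+s ⊗ 2+s
  where 2+s = sucᵣ (sucᵣ (proj (# 0)))

rootBody-↦ : ∀ s n → rootBody [ s ∷ n ∷ [] ]↦ suc n ∸ cube (2 ℕ.+ s)
rootBody-↦ s n = ⊖-↦ (suc-↦ proj) (⊗-↦ (⊗-↦ 2+s 2+s) 2+s)
  where 2+s = suc-↦ (suc-↦ proj)

n<cube[2+n] : ∀ n → n ℕ.< cube (2 ℕ.+ n)
n<cube[2+n] n = ℕₚ.≤-trans (ℕₚ.n≤1+n (suc n)) $
  ℕₚ.≤-trans (ℕₚ.m≤m*n (2 ℕ.+ n) (2 ℕ.+ n)) (ℕₚ.m≤m*n ((2 ℕ.+ n) ℕ.* (2 ℕ.+ n)) (2 ℕ.+ n))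

-- Abstract because with-abstractions over names would otherwise normalise the search.
abstract
  root : ∀ n → ∃[ s ] mu rootBody [ n ∷ [] ]↦ s
  root n with s , r , _ ← mu-total (λ s → _ , rootBody-↦ s n)
                            (↦-subst (ℕₚ.m≤n⇒m∸n≡0 (n<cube[2+n] n)) (rootBody-↦ n n)) = s , r

-- max(1, ⌊∛n⌋): the root is the least s with n < (s + 2)³.
scale : ℕ → ℕ
scale n = suc (proj₁ (root n))

offset : ℕ → ℕ
offset n = scale n ℕ.* scale n ℕ.* suc (scale n)

scaleᵣ : Rec n → Rec n
scaleᵣ f = sucᵣ (comp (mu rootBody) (f ∷ []))

scale-↦ : f [ xs ]↦ a → scaleᵣ f [ xs ]↦ scale a
scale-↦ r = suc-↦ (comp₁-↦ r (proj₂ (root _)))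

offsetᵣ : Rec n → Rec n
offsetᵣ f = scaleᵣ f ⊗ scaleᵣ f ⊗ sucᵣ (scaleᵣ f)

offset-↦ : f [ xs ]↦ a → offsetᵣ f [ xs ]↦ offset a
offset-↦ r = ⊗-↦ (⊗-↦ (scale-↦ r) (scale-↦ r)) (suc-↦ (scale-↦ r))

cube-mono-≤ : a ℕ.≤ b → cube a ℕ.≤ cube b
cube-mono-≤ a≤b = ℕₚ.*-mono-≤ (ℕₚ.*-mono-≤ a≤b a≤b) a≤b

scale-unique : ∀ k .{{_ : ℕ.NonZero k}} → cube k ℕ.≤ n → n ℕ.< cube (suc k) → scale n ≡ k
scale-unique {n} (suc s) lower upper = cong suc $ ↦-functional (mu rootBody) (proj₂ (root n)) $
  mu (↦-subst (ℕₚ.m≤n⇒m∸n≡0 upper) (rootBody-↦ s n)) λ {z} z<s →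
    n ∸ cube (2 ℕ.+ z) ,
    ↦-subst (ℕₚ.+-∸-assoc 1 (ℕₚ.≤-trans (cube-mono-≤ (s≤s z<s)) lower)) (rootBody-↦ z n)

Names : ℕ → ℚ → Set
Names n = Fraction n (offset n) (scale n)

names-total : ∀ n → ∃[ q ] Names n q
names-total n = fraction-total n (offset n) (scale n)

names-functional : Names n p → Names n q → p ≡ q
names-functional {n} e e′ = fraction-≡⇐ e e′ refl

cube-suc : ∀ k → suc (k ℕ.* k ℕ.+ (k ℕ.* k ℕ.+ cube k) ℕ.+ (k ℕ.* k ℕ.+ 3 ℕ.* k)) ≡ cube (suc k)
cube-suc = solve 1 (λ k →
  con 1 :+ (k :* k :+ (k :* k :+ k :* k :* k) :+ (k :* k :+ con 3 :* k)) :=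
  (con 1 :+ k) :* (con 1 :+ k) :* (con 1 :+ k)) refl
  where open ℕ-Solver

names-scale : ∀ k → scale n ≡ k → Fraction n (k ℕ.* k ℕ.* suc k) k q → Names n q
names-scale k refl e = e

-- Numerator and offset are shifted by the w that turns v into k³ + k².
fraction⇒names : ∀ k .{{_ : ℕ.NonZero k}} → u ℕ.≤ k ℕ.* k → v ℕ.≤ k ℕ.* k → Fraction u v k q →
                 ∃[ n ] Names n q
fraction⇒names {u} {v} {q} k u≤kk v≤kk e =
  u ℕ.+ w , names-scale k (scale-unique k lower upper)
              (subst (λ v → Fraction (u ℕ.+ w) v k q) offset≡ (fraction-shift w e))
  where
  w : ℕ
  w = (k ℕ.* k ∸ v) ℕ.+ cube k

  offset≡ : v ℕ.+ w ≡ k ℕ.* k ℕ.* suc k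
  offset≡ = begin
    v ℕ.+ w                            ≡⟨ ℕₚ.+-assoc v _ (cube k) ⟨
    v ℕ.+ (k ℕ.* k ∸ v) ℕ.+ cube k     ≡⟨ cong (ℕ._+ cube k) (ℕₚ.m+[n∸m]≡n v≤kk) ⟩
    k ℕ.* k ℕ.+ cube k                 ≡⟨ ℕₚ.*-suc (k ℕ.* k) k ⟨
    k ℕ.* k ℕ.* suc k                  ∎
    where open ≡-Reasoning

  lower : cube k ℕ.≤ u ℕ.+ w
  lower = ℕₚ.≤-trans (ℕₚ.m≤n+m (cube k) (k ℕ.* k ∸ v)) (ℕₚ.m≤n+m w u)

  upper : u ℕ.+ w ℕ.< cube (suc k)
  upper = begin-strict
    u ℕ.+ w                                ≤⟨ ℕₚ.+-mono-≤ u≤kk (ℕₚ.+-monoˡ-≤ (cube k) (ℕₚ.m∸n≤m (k ℕ.* k) v)) ⟩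
    k ℕ.* k ℕ.+ (k ℕ.* k ℕ.+ cube k)       ≤⟨ ℕₚ.m≤m+n _ (k ℕ.* k ℕ.+ 3 ℕ.* k) ⟩
    k ℕ.* k ℕ.+ (k ℕ.* k ℕ.+ cube k) ℕ.+ (k ℕ.* k ℕ.+ 3 ℕ.* k) <⟨ ℕₚ.n<1+n _ ⟩
    suc (k ℕ.* k ℕ.+ (k ℕ.* k ℕ.+ cube k) ℕ.+ (k ℕ.* k ℕ.+ 3 ℕ.* k)) ≡⟨ cube-suc k ⟩
    cube (suc k)                           ∎
    where open ℕₚ.≤-Reasoning

names-surjective : ∀ q → ∃[ n ] Names n q
names-surjective q =
  let a , b , d , e = toFraction q
      t             = suc (a ℕ.+ b)
  in spread t (suc d ℕ.* t) (ℕₚ.m≤n⇒m≤1+n (ℕₚ.m≤m+n a b)) (ℕₚ.m≤n⇒m≤1+n (ℕₚ.m≤n+m b a))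
       (ℕₚ.m≤n*m t (suc d)) (fraction-scale t e)
  where
  spread : ∀ t k .{{_ : ℕ.NonZero k}} → a ℕ.≤ t → b ℕ.≤ t → t ℕ.≤ k →
           Fraction (a ℕ.* t) (b ℕ.* t) k q → ∃[ n ] Names n q
  spread t k a≤t b≤t t≤k = fraction⇒names k
    (ℕₚ.*-mono-≤ (ℕₚ.≤-trans a≤t t≤k) t≤k) (ℕₚ.*-mono-≤ (ℕₚ.≤-trans b≤t t≤k) t≤k)

-- The admissible indexing by names

crossᵣ : (u v d u′ v′ d′ : Rec n) → Rec n
crossᵣ u v d u′ v′ d′ = u ⊗ d′ ⊕ v′ ⊗ d ⊜ u′ ⊗ d ⊕ v ⊗ d′

cross-↦ : .{{_ : ℕ.NonZero d}} .{{_ : ℕ.NonZero d′}} → ∀ {fu fv fd fu′ fv′ fd′ : Rec n} →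
  Fraction u v d p → Fraction u′ v′ d′ q →
  fu [ xs ]↦ u → fv [ xs ]↦ v → fd [ xs ]↦ d →
  fu′ [ xs ]↦ u′ → fv′ [ xs ]↦ v′ → fd′ [ xs ]↦ d′ →
  ∃[ w ] (crossᵣ fu fv fd fu′ fv′ fd′ [ xs ]↦ w × (p ≡ q → w ≡ 0) × (w ≡ 0 → p ≡ q))
cross-↦ e e′ r s t r′ s′ t′ =
  _ , ⊜-↦ (⊕-↦ (⊗-↦ r t′) (⊗-↦ s′ t)) (⊕-↦ (⊗-↦ r′ t) (⊗-↦ s t′)) ,
  (λ p≡q → distance-refl (fraction-≡⇒ e e′ p≡q)) ,
  (λ w≡0 → fraction-≡⇐ e e′ (distance-zero w≡0))

sameᵣ : Rec 2
sameᵣ = crossᵣ (proj (# 0)) (offsetᵣ (proj (# 0))) (scaleᵣ (proj (# 0)))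
               (proj (# 1)) (offsetᵣ (proj (# 1))) (scaleᵣ (proj (# 1)))

same-↦ : Names a p → Names b q →
         ∃[ w ] (sameᵣ [ a ∷ b ∷ [] ]↦ w × (p ≡ q → w ≡ 0) × (w ≡ 0 → p ≡ q))
same-↦ e e′ = cross-↦ e e′ proj (offset-↦ proj) (scale-↦ proj) proj (offset-↦ proj) (scale-↦ proj)

searchBody : Rec 4
searchBody = crossᵣ (proj (# 0)) (offsetᵣ (proj (# 0))) (scaleᵣ (proj (# 0)))
                    (proj (# 1)) (proj (# 2)) (proj (# 3))

searchBody-↦ : .{{_ : ℕ.NonZero d}} → Names n p → Fraction u v d q →
  ∃[ w ] (searchBody [ n ∷ u ∷ v ∷ d ∷ [] ]↦ w × (p ≡ q → w ≡ 0) × (w ≡ 0 → p ≡ q))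
searchBody-↦ e e′ = cross-↦ e e′ proj (offset-↦ proj) (scale-↦ proj) proj proj proj

fractionName : .{{_ : ℕ.NonZero d}} → Fraction u v d q →
               ∃[ n ] (mu searchBody [ u ∷ v ∷ d ∷ [] ]↦ n × Names n q)
fractionName {d = d} {u = u} {v = v} {q = q} e =
  let n₀ , e₀           = names-surjective q
      _ , r₀ , ⇒0 , _   = searchBody-↦ e₀ e
      n , μ↦n , r       = mu-total total (↦-subst (⇒0 refl) r₀)
      p , eₙ            = names-total n
      _ , r′ , _ , 0⇒   = searchBody-↦ eₙ e
  in n , μ↦n , subst (Names n) (0⇒ (↦-functional searchBody r′ r)) eₙ
  where
  total : ∀ n → ∃[ w ] searchBody [ n ∷ u ∷ v ∷ d ∷ [] ]↦ w
  total n = let w , r , _ = searchBody-↦ (proj₂ (names-total n)) e in w , r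

identity : Computable {1} U U
identity = record { term = proj (# 0) ; defined = λ _ → _ , tt , proj }

nameIndexing : Indexing ℚ
nameIndexing = record
  { partialFunction = record { graph = Names ; functional = names-functional }
  ; dom-enumerable  = inj₂ (identity , λ n → mk⇔ (λ _ → n , proj) (λ _ → names-total n))
  ; surjective      = names-surjective
  ; eq              = record { term = isZero sameᵣ ; defined = bit }
  ; eq-≡            = eq-≡
  ; eq-≢            = eq-≢
  }
  where
  eq-≡ : Names a p → Names b q → p ≡ q → isZero sameᵣ [ a ∷ b ∷ [] ]↦ 1
  eq-≡ e e′ p≡q =
    let _ , r , ⇒0 , _ = same-↦ e e′ in isZero-0 (↦-subst (⇒0 p≡q) r)

  eq-≢ : Names a p → Names b q → p ≢ q → isZero sameᵣ [ a ∷ b ∷ [] ]↦ 0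
  eq-≢ e e′ p≢q =
    let _ , r , _ , 0⇒ = same-↦ e e′ in isZero-≢0 (λ w≡0 → p≢q (0⇒ w≡0)) r

  bit : ∀ {xs} → ((λ n → ∃[ q ] Names n q) ^ 2) xs → ∃[ y ] (Bit y × isZero sameᵣ [ xs ]↦ y)
  bit {a ∷ b ∷ []} ((p , e) ∷ (q , e′) ∷ []) with p ℚ.≟ q
  ... | yes p≡q = 1 , inj₂ refl , eq-≡ e e′ p≡q
  ... | no  p≢q = 0 , inj₁ refl , eq-≢ e e′ p≢q

binaryComputable : (_∙_ : ℚ → ℚ → ℚ) (f : Rec 2) →
  (∀ {a b p q} → Names a p → Names b q → ∃[ n ] (f [ a ∷ b ∷ [] ]↦ n × Names n (p ∙ q))) →
  ComputableRelativelyTo nameIndexing (binary _∙_)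
binaryComputable _∙_ f spec =
  record { term = f ; defined = λ { {a ∷ b ∷ []} ((p , e) ∷ (q , e′) ∷ []) →
    let n , r , e″ = spec e e′ in n , (p ∙ q , e″) , r } } ,
  λ { {a ∷ b ∷ []} (e ∷ e′ ∷ []) → spec e e′ }

nameAdmissible : AdmissibleIndexing ⟨ℚ,+,×⟩
nameAdmissible = record
  { indexing   = nameIndexing
  ; admissible = binaryComputable _+_ sum sum-↦ ∷ binaryComputable _*_ product product-↦ ∷ []
  }
  where
  x y k l o o′ : Rec 2
  x = proj (# 0)
  y = proj (# 1)
  k = scaleᵣ x
  l = scaleᵣ y
  o = offsetᵣ x
  o′ = offsetᵣ y

  sum product : Rec 2
  sum     = comp (mu searchBody) (x ⊗ l ⊕ y ⊗ k ∷ o ⊗ l ⊕ o′ ⊗ k ∷ k ⊗ l ∷ [])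
  product = comp (mu searchBody) (x ⊗ y ⊕ o ⊗ o′ ∷ x ⊗ o′ ⊕ o ⊗ y ∷ k ⊗ l ∷ [])

  sum-↦ : Names a p → Names b q → ∃[ n ] (sum [ a ∷ b ∷ [] ]↦ n × Names n (p + q))
  sum-↦ e e′ =
    let n , r , e″ = fractionName (fraction-+ e e′)
    in n , comp (⊕-↦ (⊗-↦ proj (scale-↦ proj)) (⊗-↦ proj (scale-↦ proj)) ∷
                ⊕-↦ (⊗-↦ (offset-↦ proj) (scale-↦ proj)) (⊗-↦ (offset-↦ proj) (scale-↦ proj)) ∷
                ⊗-↦ (scale-↦ proj) (scale-↦ proj) ∷ []) r , e″

  product-↦ : Names a p → Names b q → ∃[ n ] (product [ a ∷ b ∷ [] ]↦ n × Names n (p * q))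
  product-↦ e e′ =
    let n , r , e″ = fractionName (fraction-* e e′)
    in n , comp (⊕-↦ (⊗-↦ proj proj) (⊗-↦ (offset-↦ proj) (offset-↦ proj)) ∷
                ⊕-↦ (⊗-↦ proj (offset-↦ proj)) (⊗-↦ (offset-↦ proj) proj) ∷
                ⊗-↦ (scale-↦ proj) (scale-↦ proj) ∷ []) r , e″

-- Translation between names and an arbitrary admissible indexing

module Translation (j : AdmissibleIndexing ⟨ℚ,+,×⟩) where
  open AdmissibleIndexing j hiding (functional)

  infix 4 _[_]⇓_

  _[_]⇓_ : Rec n → Vec ℕ n → ℚ → Set
  f [ xs ]⇓ q = ∃[ y ] (f [ xs ]↦ y × graph y q)

  private
    addition : ComputableRelativelyTo indexing (binary _+_)
    addition with c ∷ _ ← admissible = c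

    multiplication : ComputableRelativelyTo indexing (binary _*_)
    multiplication with _ ∷ c ∷ [] ← admissible = c

    applyBinary : {_∙_ : ℚ → ℚ → ℚ} → ComputableRelativelyTo indexing (binary _∙_) →
                  Rec n → Rec n → Rec n
    applyBinary (c , _) f g = comp (term c) (f ∷ g ∷ [])

    applyBinary-⇓ : {_∙_ : ℚ → ℚ → ℚ} (c : ComputableRelativelyTo indexing (binary _∙_)) →
                    f [ xs ]⇓ p → g [ xs ]⇓ q → applyBinary c f g [ xs ]⇓ (p ∙ q)
    applyBinary-⇓ (_ , spec) (_ , r , e) (_ , r′ , e′) =
      let z , s , e″ = spec (e ∷ e′ ∷ []) in z , comp (r ∷ r′ ∷ []) s , e″

    numeral : Rec 1
    numeral = prec (const (proj₁ (surjective 0ℚ)))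
                   (applyBinary addition (const (proj₁ (surjective 1ℚ))) (proj (# 1)))

    numeral-⇓ : ∀ n → numeral [ n ∷ [] ]⇓ ↑ n
    numeral-⇓ zero = _ , prec₀ (const-↦ _) , proj₂ (surjective 0ℚ)
    numeral-⇓ (suc n) =
      let y , r , e  = numeral-⇓ n
          z , s , e′ = applyBinary-⇓ addition (_ , const-↦ _ , proj₂ (surjective 1ℚ)) (_ , proj , e)
      in z , precₛ r s , e′

    numeralᵣ : Rec n → Rec n
    numeralᵣ f = comp numeral (f ∷ [])

    numeralᵣ-⇓ : f [ xs ]↦ a → numeralᵣ f [ xs ]⇓ ↑ a
    numeralᵣ-⇓ {a = a} r = let y , s , e = numeral-⇓ a in y , comp₁-↦ r s , e

    differsᵣ : Rec n → Rec n → Rec n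
    differsᵣ f g = isZero (comp (term eq) (f ∷ g ∷ []))

    differs-↦ : f [ xs ]⇓ p → g [ xs ]⇓ q →
                ∃[ w ] (differsᵣ f g [ xs ]↦ w × (p ≡ q → w ≡ 0) × (w ≡ 0 → p ≡ q))
    differs-↦ {p = p} {q = q} (_ , r , e) (_ , r′ , e′) with p ℚ.≟ q
    ... | yes p≡q = 0 , isZero-suc (comp (r ∷ r′ ∷ []) (eq-≡ e e′ p≡q)) , (λ _ → refl) , (λ _ → p≡q)
    ... | no  p≢q = 1 , isZero-0 (comp (r ∷ r′ ∷ []) (eq-≢ e e′ p≢q)) ,
                    (λ p≡q → contradiction p≡q p≢q) , (λ ())

    namingᵣ : Rec n → Rec n → Rec n
    namingᵣ f g = differsᵣ
      (applyBinary addition (applyBinary multiplication f (numeralᵣ (scaleᵣ g))) (numeralᵣ (offsetᵣ g)))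
      (numeralᵣ g)

    naming-↦ : f [ xs ]⇓ q → g [ xs ]↦ n →
               ∃[ w ] (namingᵣ f g [ xs ]↦ w × (Names n q → w ≡ 0) × (w ≡ 0 → Names n q))
    naming-↦ r s =
      let w , t , ⇒0 , 0⇒ = differs-↦
            (applyBinary-⇓ addition (applyBinary-⇓ multiplication r (numeralᵣ-⇓ (scale-↦ s)))
                                    (numeralᵣ-⇓ (offset-↦ s)))
            (numeralᵣ-⇓ s)
      in w , t , (λ e → ⇒0 (equation e)) , (λ w≡0 → cleared (0⇒ w≡0))

    naming-total : f [ xs ]⇓ q → g [ xs ]↦ n → ∃[ w ] namingᵣ f g [ xs ]↦ w
    naming-total r s = let w , t , _ = naming-↦ r s in w , t

    naming-complete : f [ xs ]⇓ q → g [ xs ]↦ n → Names n q → namingᵣ f g [ xs ]↦ 0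
    naming-complete r s e = let _ , t , ⇒0 , _ = naming-↦ r s in ↦-subst (⇒0 e) t

    naming-sound : f [ xs ]⇓ q → g [ xs ]↦ n → namingᵣ f g [ xs ]↦ 0 → Names n q
    naming-sound r s t = let _ , t′ , _ , 0⇒ = naming-↦ r s in 0⇒ (↦-functional (namingᵣ _ _) t′ t)

  toName : Rec 1
  toName = mu (namingᵣ (proj (# 1)) (proj (# 0)))

  toName-↦ : ∀ {x} → graph x q → ∃[ n ] (toName [ x ∷ [] ]↦ n × Names n q)
  toName-↦ {q} {x} e =
    let n₀ , e₀    = names-surjective q
        n , r , r₀ = mu-total (λ _ → naming-total x⇓ proj) (naming-complete x⇓ proj e₀)
    in n , r , naming-sound x⇓ proj r₀
    where
    x⇓ : proj (# 1) [ n ∷ x ∷ [] ]⇓ q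
    x⇓ = x , proj , e

  private
    enumeration : ∃[ f ] ((∀ m → ∃[ x ] (f [ m ∷ [] ]↦ x × dom x)) ×
                          (∀ {x} → dom x → ∃[ m ] f [ m ∷ [] ]↦ x))
    enumeration with dom-enumerable
    ... | inj₁ empty = contradiction (0ℚ , proj₂ (surjective 0ℚ)) (empty _)
    ... | inj₂ (f , dom⇔range) = term f , total , λ {x} → Equivalence.to (dom⇔range x)
      where
      total : ∀ m → ∃[ x ] (term f [ m ∷ [] ]↦ x × dom x)
      total m with x , _ , r ← Computable.defined f {m ∷ []} tt =
        x , r , Equivalence.from (dom⇔range x) (m , r)

    index : Rec 2
    index = comp (proj₁ enumeration) (proj (# 0) ∷ [])

    index-⇓ : ∀ m → ∃[ p ] index [ m ∷ n ∷ [] ]⇓ p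
    index-⇓ m = let x , r , p , e = proj₁ (proj₂ enumeration) m in p , x , comp₁-↦ proj r , e

  fromName : Rec 1
  fromName = comp (proj₁ enumeration) (mu (namingᵣ index (proj (# 1))) ∷ [])

  fromName-⇓ : Names n q → fromName [ n ∷ [] ]⇓ q
  fromName-⇓ {q = q} e =
    let x₀ , e₀        = surjective q
        m₀ , r₀        = proj₂ (proj₂ enumeration) (q , e₀)
        m , μ↦m , r    = mu-total (λ m → naming-total (proj₂ (index-⇓ m)) proj)
                           (naming-complete (x₀ , comp₁-↦ proj r₀ , e₀) proj e)
        x , s , p , e′ = proj₁ (proj₂ enumeration) m
    in x , comp₁-↦ μ↦m s ,
       subst (graph x) (names-functional (naming-sound (x , comp₁-↦ proj s , e′) proj r) e) e′

proposition6 : Stable ⟨ℚ,+,×⟩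
proposition6 = nameAdmissible , translate
  where
  translate : (j j′ : AdmissibleIndexing ⟨ℚ,+,×⟩) →
    let module J  = AdmissibleIndexing j
        module J′ = AdmissibleIndexing j′
    in ∃ λ (h : Computable (J′.dom ^ 1) J.dom) → J′.indexing ≗ J.indexing ∘ h
  translate j j′ =
    record { term = h ; defined = λ { ((q , e) ∷ []) → let y , r , e′ = h-⇓ e in y , (q , e′) , r } } ,
    λ { {x} (q , e) q′ → mk⇔ h-⇓ λ { (y , r , e′) →
      let y′ , r′ , e″ = h-⇓ e in
      subst (J′.graph x)
        (J.functional e″ (subst (λ y → J.graph y q′) (↦-functional h r r′) e′)) e } }
    where
    module J  = AdmissibleIndexing j
    module J′ = AdmissibleIndexing j′

    h : Rec 1
    h = comp (Translation.fromName j) (Translation.toName j′ ∷ [])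

    h-⇓ : ∀ {x q} → J′.graph x q → ∃[ y ] (h [ x ∷ [] ]↦ y × J.graph y q)
    h-⇓ e =
      let n , r , named = Translation.toName-↦ j′ e
          y , s , e′    = Translation.fromName-⇓ j named
      in y , comp₁-↦ r s , e′
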